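{- For all $d,t\in\mathbb{N}$, there is a constant $\eta=\eta(d,t)\in\mathbb{N}$ such that for every $t$-clean graph $G$, there is no $d$-short $\eta$-block in $G$.
   Context: A $t$-basic obstruction is a graph isomorphic to $K_{t+1}$, $K_{t,t}$, a subdivision of the $t$-by-$t$ wall $W_{t\times t}$ (hexagonal grid), or the line graph of such a subdivision; $G$ is $t$-clean if no induced subgraph of $G$ is isomorphic to a $t$-basic obstruction. A path in $G$ is an induced subgraph that is a path; length = number of edges. A $k$-block in $G$ is a set $B$ of at least $k$ vertices such that for every 2-subset $\{x,y\}\subseteq B$ there is a collection of $k$ pairwise internally disjoint paths in $G$ from $x$ to $y$; it is $d$-short if these collections can be chosen so that every path in them has length at most $d$. -}

module Defs where

open import Data.Nat using (ℕ; zero; suc; _+_; _*_; _≤_; _<_; _≡ᵇ_; _%_)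
open import Data.Bool using (Bool; true; false; _∧_; _∨_; T)
open import Data.Fin using (Fin; toℕ; fromℕ)
open import Data.Fin.Subset using (Subset; _∈_; ∣_∣)
open import Data.Product using (Σ; _×_; _,_; proj₁)
open import Data.Sum using (_⊎_; inj₁; inj₂)
open import Data.Unit using (⊤)
open import Data.Empty using (⊥)
open import Relation.Nullary using (¬_)
open import Relation.Binary.PropositionalEquality using (_≡_; _≢_)
open import Function.Bundles using (_⇔_)

Graph : Set → Set₁
Graph V = V → V → Set

Simple : ∀ {V} → Graph V → Set
Simple {V} G = (∀ (x y : V) → G x y → G y x) × (∀ (x : V) → ¬ G x x)

Contains : ∀ {W V} → Graph W → Graph V → Set
Contains {W} {V} H G =
  Σ (W → V) λ f →
    (∀ x y → f x ≡ f y → x ≡ y) × (∀ u v → H u v ⇔ G (f u) (f v))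

HEdge : ∀ {W} → Graph W → Set
HEdge {W} H = Σ W λ u → Σ W λ v → H u v

SameEdge : ∀ {W} {H : Graph W} → HEdge H → HEdge H → Set
SameEdge (u , v , _) (u' , v' , _) = (u ≡ u' × v ≡ v') ⊎ (u ≡ v' × v ≡ u')

ShareEnd : ∀ {W} {H : Graph W} → HEdge H → HEdge H → Set
ShareEnd (u , v , _) (u' , v' , _) = u ≡ u' ⊎ u ≡ v' ⊎ v ≡ u' ⊎ v ≡ v'

-- G has an induced subgraph isomorphic to the line graph L(H):
-- a map from (unordered) edges of H to V(G), injective on unordered edges,
-- such that two distinct edges map to adjacent vertices iff they share an end.
ContainsLine : ∀ {W V} → Graph W → Graph V → Set
ContainsLine {W} {V} H G =
  Σ (HEdge H → V) λ f →
    (∀ e e' → SameEdge {H = H} e e' → f e ≡ f e') ×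
    (∀ e e' → f e ≡ f e' → SameEdge {H = H} e e') ×
    (∀ e e' → ¬ SameEdge {H = H} e e' → (G (f e) (f e') ⇔ ShareEnd {H = H} e e'))

Complete : (t : ℕ) → Graph (Fin (suc t))
Complete t i j = ¬ (i ≡ j)

Biclique : (t : ℕ) → Graph (Fin t ⊎ Fin t)
Biclique t (inj₁ _) (inj₁ _) = ⊥
Biclique t (inj₁ _) (inj₂ _) = ⊤
Biclique t (inj₂ _) (inj₁ _) = ⊤
Biclique t (inj₂ _) (inj₂ _) = ⊥

-- The t-by-t wall (elementary hexagonal wall).
-- Start from t rows 0..t-1, each a path on columns 0..2t-1
-- (horizontal edges (i,j)(i,j+1)), with vertical edges (i,j)(i+1,j)
-- whenever i+j is even; then delete the (two) vertices of degree one.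

evenᵇ : ℕ → Bool
evenᵇ n = (n % 2) ≡ᵇ 0

wallStep : ℕ → ℕ → ℕ → ℕ → Bool
wallStep i j i' j' = ((i ≡ᵇ i') ∧ (suc j ≡ᵇ j')) ∨ ((j ≡ᵇ j') ∧ ((suc i ≡ᵇ i') ∧ evenᵇ (i + j)))

-- the degree-one vertices of the raw brick pattern
pendant : (t : ℕ) → ℕ → ℕ → Bool
pendant t i j =
  ((i ≡ᵇ 0) ∧ (suc j ≡ᵇ 2 * t)) ∨
  ((suc i ≡ᵇ t) ∧ (((j ≡ᵇ 0) ∨ (suc j ≡ᵇ 2 * t)) ∧ evenᵇ (i + j)))

notᵇ : Bool → Bool
notᵇ true = false
notᵇ false = true

WallV : ℕ → Set
WallV t = Σ (Fin t × Fin (2 * t)) λ p →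
  T (notᵇ (pendant t (toℕ (Data.Product.proj₁ p)) (toℕ (Data.Product.proj₂ p))))

row col : ∀ {t} → WallV t → ℕ
row ((i , _) , _) = toℕ i
col ((_ , j) , _) = toℕ j

wallAdjᵇ : ∀ {t} → WallV t → WallV t → Bool
wallAdjᵇ x y = wallStep (row x) (col x) (row y) (col y) ∨ wallStep (row y) (col y) (row x) (col x)

-- rank used only to orient each edge once (injective)
wallRank : ∀ {t} → WallV t → ℕ
wallRank {t} x = row x * (2 * t) + col x

-- Subdivisions.  Given a graph H (Bool adjacency) and an injective rank
-- used to pick one orientation of each edge, an edge e = (u,v) with
-- rk u < rk v is replaced by a path u - c₀ - … - c_{ℓ e - 1} - v with
-- ℓ e ≥ 0 new internal vertices (so the path has length ℓ e + 1 ≥ 1).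

module Subdivision {V : Set} (adj : V → V → Bool) (rk : V → ℕ) where

  Edge : Set
  Edge = Σ V λ u → Σ V λ v → T (adj u v) × rk u < rk v

  SubV : (Edge → ℕ) → Set
  SubV ℓ = V ⊎ Σ Edge (λ e → Fin (ℓ e))

  -- x sits at position p (0 … ℓ e + 1) along the path replacing e
  At : (ℓ : Edge → ℕ) → SubV ℓ → Edge → ℕ → Set
  At ℓ (inj₁ w) e@(u , v , _) p = (w ≡ u × p ≡ 0) ⊎ (w ≡ v × p ≡ suc (ℓ e))
  At ℓ (inj₂ (e' , c)) e p = e' ≡ e × p ≡ suc (toℕ c)

  Sub : (ℓ : Edge → ℕ) → Graph (SubV ℓ)
  Sub ℓ x y = Σ Edge λ e → Σ ℕ λ p →
    (At ℓ x e p × At ℓ y e (suc p)) ⊎ (At ℓ y e p × At ℓ x e (suc p))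

WallEdge : ℕ → Set
WallEdge t = Subdivision.Edge (wallAdjᵇ {t}) wallRank

SubWall : (t : ℕ) (ℓ : WallEdge t → ℕ) → Graph (Subdivision.SubV (wallAdjᵇ {t}) wallRank ℓ)
SubWall t ℓ = Subdivision.Sub (wallAdjᵇ {t}) wallRank ℓ

Clean : ∀ {V} → ℕ → Graph V → Set
Clean t G =
  ¬ Contains (Complete t) G ×
  ¬ Contains (Biclique t) G ×
  (∀ (ℓ : WallEdge t → ℕ) → ¬ Contains (SubWall t ℓ) G) ×
  (∀ (ℓ : WallEdge t → ℕ) → ¬ ContainsLine (SubWall t ℓ) G)

record Path {n : ℕ} (G : Graph (Fin n)) (x y : Fin n) : Set where
  field
    len : ℕ
    vtx : Fin (suc len) → Fin n
    inj : ∀ a b → vtx a ≡ vtx b → a ≡ b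
    start : vtx Data.Fin.zero ≡ x
    end : vtx (fromℕ len) ≡ y
    induced : ∀ a b → G (vtx a) (vtx b) ⇔ (suc (toℕ a) ≡ toℕ b ⊎ suc (toℕ b) ≡ toℕ a)

open Path public

Interior : ∀ {n} {G : Graph (Fin n)} {x y} → Path G x y → Fin n → Set
Interior P w = Σ (Fin (suc (len P))) λ a → 0 < toℕ a × toℕ a < len P × vtx P a ≡ w

-- distinct paths with disjoint interiors (two paths with the same ends and
-- disjoint interiors are equal iff both are the single edge xy)
InternallyDisjoint : ∀ {n} {G : Graph (Fin n)} {x y} → Path G x y → Path G x y → Set
InternallyDisjoint P Q =
  (∀ w → Interior P w → Interior Q w → ⊥) × ¬ (len P ≡ 1 × len Q ≡ 1)

ShortBlock : ∀ {n} → Graph (Fin n) → (d k : ℕ) → Subset n → Set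
ShortBlock {n} G d k B =
  k ≤ ∣ B ∣ ×
  (∀ (x y : Fin n) → x ∈ B → y ∈ B → x ≢ y →
    Σ (Fin k → Path G x y) λ ps →
      (∀ i → len (ps i) ≤ d) ×
      (∀ i j → i ≢ j → InternallyDisjoint (ps i) (ps j)))

{-# OPTIONS --safe #-}
-- Call two vertices touching if they are equal or adjacent. By Ramsey, two large families of distinct vertices in a
-- clean graph cannot touch completely: stable subfamilies of both would span an induced biclique. Start from a stable
-- set of m block vertices and, for each pair x, y of them, a large bundle of disjoint short x-y paths, thinned out so
-- that "z touches position p of a strand" is the same for all strands. For given x, y, p few z touch position p
-- throughout, so by a union bound some tuple of h block vertices has no vertex touching the interior of a bundle
-- between two others. Bipartite Ramsey, applied to each pair of bundles and of positions, then yields one path per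
-- pair of hubs such that the interiors do not touch each other: an induced subdivision of K_h in which every edge is
-- subdivided, hence of every graph on h vertices, in particular of the wall. As the goal is a negation, adjacency may
-- be taken to be decidable.

module Submission where

open import Defs
open import Data.Nat using (ℕ; zero; suc; pred; _+_; _*_; _^_; _≤_; _<_; z≤n; s≤s; z<s; _<?_; >-nonZero)
open import Data.Nat.Properties using (+-0-commutativeMonoid; +-suc; +-mono-≤; *-distribˡ-+; *-identityˡ; *-identityʳ; ≮⇒≥; *-monoʳ-≤; *-assoc; *-comm; *-cancelʳ-≤; m^n>0; ≤-refl; ≤-trans; ≤-reflexive; <-irrefl; <-irrelevant; <⇒≤; n≤1+n; <⇒≱; module ≤-Reasoning)
open import Data.Fin using (Fin; zero; suc; _≟_; _↑ˡ_; _↑ʳ_; toℕ; fromℕ; fromℕ<; combine; remQuot)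
open import Data.Fin.Properties using (suc-injective; toℕ<n; toℕ-injective; toℕ-fromℕ<; inject≤-injective; remQuot-combine; combine-injective; ↑ˡ-injective; ↑ʳ-injective; all?; any?)
open import Data.Fin.Subset using (Subset; _∈_; ∣_∣)
open import Data.Product using (Σ; _×_; _,_; proj₁; proj₂; map₂; ∃; ∃-syntax)
open import Data.Sum using (_⊎_; inj₁; inj₂)
open import Data.Vec using (Vec; []; _∷_; _[_]≔_; lookup; here; there)
open import Data.Vec.Properties using (lookup∘update; lookup∘update′)
open import Data.Bool using (Bool; true; false)
open import Data.Bool.Properties using (T-irrelevant)
open import Data.Empty using (⊥-elim)
open import Function using (_∘_; _↣_; mk↣; _⇔_; mk⇔; Injection; Equivalence)
open import Function.Construct.Composition using (_↣-∘_)
open import Relation.Nullary using (¬_; Dec; yes; no)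
open import Relation.Nullary.Decidable using (via-injection; _×-dec_; _⊎-dec_; ¬?; decidable-stable; ¬¬-excluded-middle)
open import Relation.Binary.PropositionalEquality using (_≡_; _≢_; refl; sym; trans; cong; cong₂; subst; subst₂)
open import Algebra.Properties.CommutativeMonoid.Sum +-0-commutativeMonoid using (sum; sum-cong-≗; ∑-comm)

open Injection using (to; injective)

-- Ramsey theorems

empty : ∀ {n} → Fin 0 ↣ Fin n
empty = mk↣ {to = λ ()} λ { {()} }

cons : ∀ {k n} → Fin k ↣ Fin n → Fin (suc k) ↣ Fin (suc n)
cons {k} {n} σ = mk↣ {to = f} (λ {i} {j} → f-inj i j)
  where
  f : Fin (suc k) → Fin (suc n)
  f zero = zero
  f (suc i) = suc (to σ i)
  f-inj : ∀ i j → f i ≡ f j → i ≡ j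
  f-inj zero zero _ = refl
  f-inj (suc i) (suc j) eq = cong suc (injective σ (suc-injective eq))

shift : ∀ {k n} → Fin k ↣ Fin n → Fin k ↣ Fin (suc n)
shift σ = mk↣ suc-injective ↣-∘ σ

split : ∀ {n} {P : Fin n → Set} → (∀ i → Dec (P i)) → ∀ a b → a + b ≤ n →
  (Σ (Fin a ↣ Fin n) λ σ → ∀ i → P (to σ i)) ⊎ (Σ (Fin b ↣ Fin n) λ σ → ∀ i → ¬ P (to σ i))
split P? zero b le = inj₁ (empty , λ ())
split P? (suc a) zero le = inj₂ (empty , λ ())
split {suc n} P? (suc a) (suc b) (s≤s le) with P? zero
... | yes p with split (P? ∘ suc) a (suc b) le
...   | inj₁ (σ , h) = inj₁ (cons σ , λ { zero → p ; (suc i) → h i })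
...   | inj₂ (σ , h) = inj₂ (shift σ , h)
split {suc n} P? (suc a) (suc b) (s≤s le) | no ¬p with split (P? ∘ suc) (suc a) b (subst (_≤ n) (+-suc a b) le)
...   | inj₁ (σ , h) = inj₁ (shift σ , h)
...   | inj₂ (σ , h) = inj₂ (cons σ , λ { zero → ¬p ; (suc i) → h i })

R : ℕ → ℕ → ℕ
R zero b = 0
R (suc a) zero = 0
R (suc a) (suc b) = suc (R a (suc b) + R (suc a) b)

Pairwise : ∀ {A : Set} {k} → (A → A → Set) → (Fin k → A) → Set
Pairwise E f = ∀ i j → i ≢ j → E (f i) (f j)

pairwise-cons : ∀ {n k} {E : Fin (suc n) → Fin (suc n) → Set} → (∀ {i j} → E i j → E j i) →
  (σ : Fin k ↣ Fin n) → (∀ i → E zero (suc (to σ i))) → Pairwise E (suc ∘ to σ) → Pairwise E (to (cons σ))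
pairwise-cons E-sym σ h hs zero zero ne = ⊥-elim (ne refl)
pairwise-cons E-sym σ h hs zero (suc j) ne = h j
pairwise-cons E-sym σ h hs (suc i) zero ne = E-sym (h i)
pairwise-cons E-sym σ h hs (suc i) (suc j) ne = hs i j (ne ∘ cong suc)

ramsey : ∀ a b {E : Fin (R a b) → Fin (R a b) → Set} → (∀ i j → Dec (E i j)) → (∀ {i j} → E i j → E j i) →
  (Σ (Fin a ↣ Fin (R a b)) λ σ → Pairwise E (to σ)) ⊎
  (Σ (Fin b ↣ Fin (R a b)) λ σ → Pairwise (λ x y → ¬ E x y) (to σ))
ramsey zero b E? E-sym = inj₁ (empty , λ ())
ramsey (suc a) zero E? E-sym = inj₂ (empty , λ ())
ramsey (suc a) (suc b) {E} E? E-sym with split (λ i → E? zero (suc i)) (R a (suc b)) (R (suc a) b) ≤-refl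
... | inj₁ (ρ , h) with ramsey a (suc b) (λ i j → E? (suc (to ρ i)) (suc (to ρ j))) E-sym
...   | inj₁ (σ , hs) = inj₁ (cons (ρ ↣-∘ σ) , pairwise-cons {E = E} E-sym (ρ ↣-∘ σ) (h ∘ to σ) hs)
...   | inj₂ (σ , hs) = inj₂ (shift (ρ ↣-∘ σ) , hs)
ramsey (suc a) (suc b) {E} E? E-sym | inj₂ (ρ , h) with ramsey (suc a) b (λ i j → E? (suc (to ρ i)) (suc (to ρ j))) E-sym
...   | inj₁ (σ , hs) = inj₁ (shift (ρ ↣-∘ σ) , hs)
...   | inj₂ (σ , hs) = inj₂ (cons (ρ ↣-∘ σ) , pairwise-cons {E = λ x y → ¬ E x y} (_∘ E-sym) (ρ ↣-∘ σ) (h ∘ to σ) hs)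

homSize : ℕ → ℕ → ℕ
homSize zero L = L
homSize (suc k) L = homSize k L + homSize k L

homogenise : ∀ k L {Q : Fin k → Fin (homSize k L) → Set} → (∀ q i → Dec (Q q i)) →
  Σ (Fin L ↣ Fin (homSize k L)) λ σ → ∀ q → (∀ i → Q q (to σ i)) ⊎ (∀ i → ¬ Q q (to σ i))
homogenise zero L Q? = mk↣ (λ eq → eq) , λ ()
homogenise (suc k) L {Q} Q? with split (Q? zero) (homSize k L) (homSize k L) ≤-refl
... | inj₁ (ρ , h) with homogenise k L (λ q i → Q? (suc q) (to ρ i))
...   | σ , hs = ρ ↣-∘ σ , λ { zero → inj₁ (h ∘ to σ) ; (suc q) → hs q }
homogenise (suc k) L {Q} Q? | inj₂ (ρ , h) with homogenise k L (λ q i → Q? (suc q) (to ρ i))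
...   | σ , hs = ρ ↣-∘ σ , λ { zero → inj₂ (h ∘ to σ) ; (suc q) → hs q }

left : ∀ {a} b → Fin a ↣ Fin (a + b)
left b = mk↣ (↑ˡ-injective b _ _)

right : ∀ a {b} → Fin b ↣ Fin (a + b)
right a = mk↣ (↑ʳ-injective a _ _)

pairSize : ℕ → ℕ → ℕ
pairSize T L = (T + L) + homSize (T + L) (T + L)

Rectangle : ∀ {N} → ℕ → (Fin N → Fin N → Set) → Set
Rectangle {N} T Q = Σ (Fin T ↣ Fin N) λ σ → Σ (Fin T ↣ Fin N) λ τ → ∀ i j → Q (to σ i) (to τ j)

bipartite-ramsey : ∀ T L {Q : Fin (pairSize T L) → Fin (pairSize T L) → Set} → (∀ i j → Dec (Q i j)) →
  Rectangle T Q ⊎ Rectangle L (λ i j → ¬ Q i j)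
bipartite-ramsey T L {Q} Q? with homogenise c c (λ q i → Q? (q ↑ˡ homSize c c) (c ↑ʳ i))
  where c = T + L
... | ρ , const with split (λ q → all? (λ i → Q? (q ↑ˡ _) ((T + L) ↑ʳ to ρ i))) T L ≤-refl
...   | inj₁ (σ , full) = inj₁ (left _ ↣-∘ σ , right _ ↣-∘ (ρ ↣-∘ left L) , λ i j → full i (j ↑ˡ L))
...   | inj₂ (σ , notfull) = inj₂ (left _ ↣-∘ σ , right _ ↣-∘ (ρ ↣-∘ right T) , λ i j → none (const (to σ i)) (notfull i) (T ↑ʳ j))
  where
  none : ∀ {A : Set} {P : A → Set} → (∀ i → P i) ⊎ (∀ i → ¬ P i) → ¬ (∀ i → P i) → ∀ i → ¬ P i
  none (inj₁ all) notall = ⊥-elim (notall all)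
  none (inj₂ none) _ = none

multiSize : ℕ → ℕ → ℕ → ℕ
multiSize zero T L = L
multiSize (suc k) T L = pairSize T (multiSize k T L)

multi-bipartite-ramsey : ∀ k T L {Q : Fin k → Fin (multiSize k T L) → Fin (multiSize k T L) → Set} →
  (∀ q i j → Dec (Q q i j)) → (∃ λ q → Rectangle T (Q q)) ⊎ Rectangle L (λ i j → ∀ q → ¬ Q q i j)
multi-bipartite-ramsey zero T L Q? = inj₂ (mk↣ (λ eq → eq) , mk↣ (λ eq → eq) , λ _ _ ())
multi-bipartite-ramsey (suc k) T L Q? with bipartite-ramsey T (multiSize k T L) (Q? zero)
... | inj₁ full = inj₁ (zero , full)
... | inj₂ (σ , τ , none) with multi-bipartite-ramsey k T L (λ q i j → Q? (suc q) (to σ i) (to τ j))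
...   | inj₁ (q , σ′ , τ′ , full) = inj₁ (suc q , σ ↣-∘ σ′ , τ ↣-∘ τ′ , full)
...   | inj₂ (σ′ , τ′ , nones) =
  inj₂ (σ ↣-∘ σ′ , τ ↣-∘ τ′ , λ { i j zero → none (to σ′ i) (to τ′ j) ; i j (suc q) → nones i j q })

clearSize : ℕ → ℕ → ℕ → ℕ → ℕ
clearSize k T zero L = L
clearSize k T (suc E) L = multiSize k T (clearSize k T E L)

clearAllSize : ℕ → ℕ → ℕ → ℕ
clearAllSize k T zero = 1
clearAllSize k T (suc E) = clearSize k T E (suc (clearAllSize k T E))

module _ {A : Set} {k : ℕ} {Q : Fin k → A → A → Set} (Q? : ∀ q x y → Dec (Q q x y)) (T : ℕ) where

  Apart : A → A → Set
  Apart x y = ∀ q → ¬ Q q x y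

  NoRectangle : ∀ {N} → (Fin N → A) → (Fin N → A) → Set
  NoRectangle f g = ∀ q → ¬ Rectangle T (λ i j → Q q (f i) (g j))

  clear-one : ∀ E L (f : Fin (clearSize k T E L) → A) (g : Fin E → Fin (clearSize k T E L) → A) → (∀ e → NoRectangle f (g e)) →
    Σ (Fin L ↣ Fin (clearSize k T E L)) λ σ → Σ (Fin E → Fin L ↣ Fin (clearSize k T E L)) λ τ →
      ∀ e i j → Apart (f (to σ i)) (g e (to (τ e) j))
  clear-one zero L f g none = mk↣ (λ eq → eq) , (λ ()) , λ ()
  clear-one (suc E) L f g none with multi-bipartite-ramsey k T (clearSize k T E L) (λ q i j → Q? q (f i) (g zero j))
  ... | inj₁ (q , full) = ⊥-elim (none zero q full)
  ... | inj₂ (σ , τ , apart) with clear-one E L (f ∘ to σ) (λ e → g (suc e) ∘ to σ)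
          (λ { e q (α , β , full) → none (suc e) q (σ ↣-∘ α , σ ↣-∘ β , full) })
  ...   | σ′ , τ′ , aparts =
    σ ↣-∘ σ′ , (λ { zero → τ ↣-∘ σ′ ; (suc e) → σ ↣-∘ τ′ e }) ,
    λ { zero i j → apart (to σ′ i) (to σ′ j) ; (suc e) i j → aparts e i j }

  clear-all : (∀ {x y} → Apart x y → Apart y x) → ∀ E (f : Fin E → Fin (clearAllSize k T E) → A) → Pairwise NoRectangle f →
    Σ (Fin E → Fin (clearAllSize k T E)) λ c → ∀ e e′ → e ≢ e′ → Apart (f e (c e)) (f e′ (c e′))
  clear-all apart-sym zero f none = (λ ()) , λ ()
  clear-all apart-sym (suc E) f none
    with clear-one E (suc (clearAllSize k T E)) (f zero) (f ∘ suc) (λ e → none zero (suc e) λ ())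
  ... | σ , τ , apart with clear-all apart-sym E (λ e → f (suc e) ∘ to (τ e) ∘ suc)
          (λ { e e′ ne q (α , β , full) → none (suc e) (suc e′) (ne ∘ suc-injective) q
                (τ e ↣-∘ shift α , τ e′ ↣-∘ shift β , full) })
  ...   | c , aparts = (λ { zero → to σ zero ; (suc e) → to (τ e) (suc (c e)) }) ,
    λ { zero zero ne → ⊥-elim (ne refl)
      ; zero (suc e′) ne → apart e′ zero (suc (c e′))
      ; (suc e) zero ne → apart-sym (apart e zero (suc (c e)))
      ; (suc e) (suc e′) ne → aparts e e′ (ne ∘ cong suc) }

-- Counting tuples

tupleSum : ∀ h {m} → (Vec (Fin m) h → ℕ) → ℕ
tupleSum zero w = w []
tupleSum (suc h) w = sum λ c → tupleSum h (w ∘ (c ∷_))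

sum-mono : ∀ {m} {f g : Fin m → ℕ} → (∀ i → f i ≤ g i) → sum f ≤ sum g
sum-mono {zero} le = z≤n
sum-mono {suc m} le = +-mono-≤ (le zero) (sum-mono (le ∘ suc))

sum-const : ∀ m {c} → sum {m} (λ _ → c) ≡ m * c
sum-const zero = refl
sum-const (suc m) = cong (_ +_) (sum-const m)

*-sum : ∀ {m} c (f : Fin m → ℕ) → c * sum f ≡ sum (λ i → c * f i)
*-sum {zero} c f = *-comm c 0
*-sum {suc m} c f = trans (*-distribˡ-+ c (f zero) _) (cong (c * f zero +_) (*-sum c (f ∘ suc)))

tupleSum-mono : ∀ h {m} {w w′ : Vec (Fin m) h → ℕ} → (∀ v → w v ≤ w′ v) → tupleSum h w ≤ tupleSum h w′
tupleSum-mono zero le = le []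
tupleSum-mono (suc h) le = sum-mono λ c → tupleSum-mono h (le ∘ (c ∷_))

tupleSum-const : ∀ h {m c} → tupleSum h {m} (λ _ → c) ≡ m ^ h * c
tupleSum-const zero {c = c} = sym (*-identityˡ c)
tupleSum-const (suc h) {m} {c} =
  trans (sum-cong-≗ {m} λ _ → tupleSum-const h) (trans (sum-const m) (sym (*-assoc m (m ^ h) c)))

tupleSum-sum : ∀ h {m k} (w : Fin k → Vec (Fin m) h → ℕ) →
  tupleSum h (λ v → sum (λ e → w e v)) ≡ sum (λ e → tupleSum h (w e))
tupleSum-sum zero w = refl
tupleSum-sum (suc h) {m} {k} w =
  trans (sum-cong-≗ {m} λ c → tupleSum-sum h (λ e → w e ∘ (c ∷_))) (∑-comm {m} {k} λ c e → tupleSum h (w e ∘ (c ∷_)))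

tupleSum-fibre : ∀ h {m s} (w : Vec (Fin m) h → ℕ) (k : Fin h) →
  (∀ v → sum (λ c → w (v [ k ]≔ c)) ≤ s) → m * tupleSum h w ≤ m ^ h * s
tupleSum-fibre (suc h) {zero} w zero le = z≤n
tupleSum-fibre (suc h) {suc m} {s} w zero le = begin
  suc m * tupleSum (suc h) w                           ≡⟨ cong (suc m *_) (sym (tupleSum-sum h (λ c → w ∘ (c ∷_)))) ⟩
  suc m * tupleSum h (λ v → sum (λ c → w (c ∷ v)))     ≤⟨ *-monoʳ-≤ (suc m) (tupleSum-mono h (λ v → le (zero ∷ v))) ⟩
  suc m * tupleSum h {suc m} (λ _ → s)                 ≡⟨ cong (suc m *_) (tupleSum-const h) ⟩
  suc m * (suc m ^ h * s)                              ≡⟨ sym (*-assoc (suc m) (suc m ^ h) s) ⟩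
  suc m ^ suc h * s                                    ∎
  where open ≤-Reasoning
tupleSum-fibre (suc h) {m} {s} w (suc k) le = begin
  m * tupleSum (suc h) w                        ≡⟨ *-sum {m} m _ ⟩
  sum (λ c → m * tupleSum h (w ∘ (c ∷_)))       ≤⟨ sum-mono (λ c → tupleSum-fibre h (w ∘ (c ∷_)) k (λ v → le (c ∷ v))) ⟩
  sum {m} (λ _ → m ^ h * s)                     ≡⟨ sum-const m ⟩
  m * (m ^ h * s)                               ≡⟨ sym (*-assoc m (m ^ h) s) ⟩
  m ^ suc h * s                                 ∎
  where open ≤-Reasoning

indicator : ∀ {A : Set} → Dec A → ℕ
indicator (yes _) = 1
indicator (no _) = 0

select : ∀ {m} {P : Fin m → Set} (P? : ∀ i → Dec (P i)) s → s ≤ sum (indicator ∘ P?) →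
  Σ (Fin s ↣ Fin m) λ σ → ∀ i → P (to σ i)
select P? zero le = empty , λ ()
select {suc m} P? (suc s) le with P? zero
select {suc m} P? (suc s) (s≤s le) | yes p with select (P? ∘ suc) s le
... | σ , h = cons σ , λ { zero → p ; (suc i) → h i }
select {suc m} P? (suc s) le | no _ with select (P? ∘ suc) (suc s) le
... | σ , h = shift σ , h

indicator≤sum : ∀ {k} {P : Fin k → Set} (P? : ∀ i → Dec (P i)) → ∃ P → 1 ≤ sum (indicator ∘ P?)
indicator≤sum {suc k} P? (e , p) with P? zero
indicator≤sum {suc k} P? (e , p) | yes _ = s≤s z≤n
indicator≤sum {suc k} P? (zero , p) | no ¬p = ⊥-elim (¬p p)
indicator≤sum {suc k} P? (suc e , p) | no _ = indicator≤sum (P? ∘ suc) (e , p)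

-- An event all of whose lines in direction dir e contain at most s bad points has density at most s / m.
union-bound : ∀ h {m k s} {P : Fin k → Vec (Fin m) h → Set} → (∀ e v → Dec (P e v)) → (dir : Fin k → Fin h) →
  (∀ e v (σ : Fin (suc s) ↣ Fin m) → ¬ (∀ i → P e (v [ dir e ]≔ to σ i))) →
  k * s < m → ¬ (∀ v → ∃ λ e → P e v)
union-bound h {suc m} {k} {s} {P} P? dir few k*s<m always = <⇒≱ k*s<m (*-cancelʳ-≤ (suc m) (k * s) (suc m ^ h) le)
  where
  open ≤-Reasoning
  instance
    m^h≢0 = >-nonZero (m^n>0 (suc m) h)
  w : Fin k → Vec (Fin (suc m)) h → ℕ
  w e v = indicator (P? e v)
  few-bad : ∀ e v → sum (λ c → w e (v [ dir e ]≔ c)) ≤ s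
  few-bad e v = ≮⇒≥ λ lt → let (σ , bad) = select (λ c → P? e (v [ dir e ]≔ c)) (suc s) lt in few e v σ bad
  le : suc m * suc m ^ h ≤ k * s * suc m ^ h
  le = begin
    suc m * suc m ^ h                                ≡⟨ cong (suc m *_) (sym (trans (tupleSum-const h) (*-identityʳ _))) ⟩
    suc m * tupleSum h {suc m} (λ _ → 1)             ≤⟨ *-monoʳ-≤ (suc m) (tupleSum-mono h (λ v → indicator≤sum (λ e → P? e v) (always v))) ⟩
    suc m * tupleSum h (λ v → sum (λ e → w e v))     ≡⟨ cong (suc m *_) (tupleSum-sum h w) ⟩
    suc m * sum (λ e → tupleSum h (w e))             ≡⟨ *-sum {k} (suc m) _ ⟩
    sum (λ e → suc m * tupleSum h (w e))             ≤⟨ sum-mono (λ e → tupleSum-fibre h (w e) (dir e) (few-bad e)) ⟩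
    sum {k} (λ _ → suc m ^ h * s)                    ≡⟨ sum-const k ⟩
    k * (suc m ^ h * s)                              ≡⟨ cong (k *_) (*-comm _ s) ⟩
    k * (s * suc m ^ h)                              ≡⟨ sym (*-assoc k s _) ⟩
    k * s * suc m ^ h                                ∎

-- Induced subdivisions

record Segment (n : ℕ) : Set where
  field
    size : ℕ
    at : ℕ → Fin n

open Segment

Inner : ∀ {n} → Segment n → ℕ → Set
Inner S p = 0 < p × p < size S

record IsPath {n} (G : Graph (Fin n)) (S : Segment n) (x y : Fin n) : Set where
  field
    at-start : at S 0 ≡ x
    at-end : at S (size S) ≡ y
    at-injective : ∀ {p q} → p ≤ size S → q ≤ size S → at S p ≡ at S q → p ≡ q
    at-step : ∀ {p} → suc p ≤ size S → G (at S p) (at S (suc p))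
    at-adjacent : ∀ {p q} → p ≤ size S → q ≤ size S → G (at S p) (at S q) → suc p ≡ q ⊎ suc q ≡ p

open IsPath

Touch : ∀ {n} → Graph (Fin n) → Fin n → Fin n → Set
Touch G u v = u ≡ v ⊎ G u v

touch-sym : ∀ {n} {G : Graph (Fin n)} → Simple G → ∀ {u v} → Touch G u v → Touch G v u
touch-sym simple (inj₁ eq) = inj₁ (sym eq)
touch-sym simple (inj₂ g) = inj₂ (proj₁ simple _ _ g)

record Web {n} (G : Graph (Fin n)) (h : ℕ) : Set where
  field
    hub : Fin h → Fin n
    link : Fin h → Fin h → Segment n
    link-path : ∀ {i j} → i ≢ j → IsPath G (link i j) (hub i) (hub j)
    hubs-apart : ∀ {i j} → i ≢ j → ¬ Touch G (hub i) (hub j)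
    hub-link-apart : ∀ {i j k p} → k ≢ i → k ≢ j → Inner (link i j) p → ¬ Touch G (hub k) (at (link i j) p)
    links-apart : ∀ {i j i′ j′ p q} → ¬ (i ≡ i′ × j ≡ j′) → Inner (link i j) p → Inner (link i′ j′) q →
      ¬ Touch G (at (link i j) p) (at (link i′ j′) q)

module _ {n h : ℕ} {G : Graph (Fin n)} (simple : Simple G) (web : Web G h)
         {V : Set} (adj : V → V → Bool) (rk : V → ℕ) (idx : V ↣ Fin h) where

  open Web web
  open Subdivision adj rk

  _≟V_ : (u v : V) → Dec (u ≡ v)
  _≟V_ = via-injection idx _≟_

  edge-≡ : {e e′ : Edge} → proj₁ e ≡ proj₁ e′ → proj₁ (proj₂ e) ≡ proj₁ (proj₂ e′) → e ≡ e′
  edge-≡ {u , v , a , l} {_ , _ , a′ , l′} refl refl = cong₂ (λ a l → u , v , a , l) (T-irrelevant a a′) (<-irrelevant l l′)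

  segment : Edge → Segment n
  segment (u , v , _) = link (to idx u) (to idx v)

  idx≢ : ∀ {u v} → u ≢ v → to idx u ≢ to idx v
  idx≢ ne eq = ne (injective idx eq)

  segment-path : (e : Edge) → IsPath G (segment e) (hub (to idx (proj₁ e))) (hub (to idx (proj₁ (proj₂ e))))
  segment-path (u , v , _ , lt) = link-path (idx≢ λ eq → <-irrefl (cong rk eq) lt)

  ℓ : Edge → ℕ
  ℓ e = pred (size (segment e))

  suc-ℓ : ∀ e → suc (ℓ e) ≡ size (segment e)
  suc-ℓ e@(u , v , _ , lt) with size (segment e) | at-end (segment-path e)
  ... | suc _ | _ = refl
  ... | zero | end = ⊥-elim (hubs-apart (idx≢ λ eq → <-irrefl (cong rk eq) lt)
                       (inj₁ (trans (sym (at-start (segment-path e))) end)))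

  inner : ∀ e (c : Fin (ℓ e)) → Inner (segment e) (suc (toℕ c))
  inner e c = z<s , subst (suc (toℕ c) <_) (suc-ℓ e) (s≤s (toℕ<n c))

  place : SubV ℓ → Fin n
  place (inj₁ w) = hub (to idx w)
  place (inj₂ (e , c)) = at (segment e) (suc (toℕ c))

  place-at : ∀ x {e p} → At ℓ x e p → place x ≡ at (segment e) p × p ≤ size (segment e)
  place-at (inj₁ w) {e} (inj₁ (refl , refl)) = sym (at-start (segment-path e)) , z≤n
  place-at (inj₁ w) {e} (inj₂ (refl , refl)) =
    trans (sym (at-end (segment-path e))) (cong (at (segment e)) (sym (suc-ℓ e))) , ≤-reflexive (suc-ℓ e)
  place-at (inj₂ (e , c)) (refl , refl) = refl , <⇒≤ (proj₂ (inner e c))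

  at-unique : ∀ x y {e p} → At ℓ x e p → At ℓ y e p → x ≡ y
  at-unique (inj₁ _) (inj₁ _) (inj₁ (refl , refl)) (inj₁ (refl , _)) = refl
  at-unique (inj₁ _) (inj₁ _) (inj₁ (refl , refl)) (inj₂ (_ , ()))
  at-unique (inj₁ _) (inj₁ _) (inj₂ (refl , refl)) (inj₁ (_ , ()))
  at-unique (inj₁ _) (inj₁ _) (inj₂ (refl , refl)) (inj₂ (refl , _)) = refl
  at-unique (inj₁ _) (inj₂ _) (inj₁ (refl , refl)) (_ , ())
  at-unique (inj₁ _) (inj₂ (_ , c)) (inj₂ (refl , refl)) (refl , eq) = ⊥-elim (<-irrefl (sym (cong pred eq)) (toℕ<n c))
  at-unique (inj₂ _) (inj₁ _) (_ , ()) (inj₁ (refl , refl))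
  at-unique (inj₂ (_ , c)) (inj₁ _) (refl , eq) (inj₂ (refl , refl)) = ⊥-elim (<-irrefl (sym (cong pred eq)) (toℕ<n c))
  at-unique (inj₂ (e , c)) (inj₂ (_ , c′)) (refl , eq) (refl , eq′) =
    cong (λ c → inj₂ (e , c)) (toℕ-injective (cong pred (trans (sym eq) eq′)))

  CommonEdge : SubV ℓ → SubV ℓ → Set
  CommonEdge x y = Σ Edge λ e → Σ ℕ λ p → Σ ℕ λ q → At ℓ x e p × At ℓ y e q

  hub-meets-inner : ∀ w e c → Touch G (hub (to idx w)) (at (segment e) (suc (toℕ c))) → CommonEdge (inj₁ w) (inj₂ (e , c))
  hub-meets-inner w e@(u , v , _) c touch with w ≟V u | w ≟V v
  ... | yes w≡u | _ = e , 0 , suc (toℕ c) , inj₁ (w≡u , refl) , refl , refl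
  ... | no _ | yes w≡v = e , suc (ℓ e) , suc (toℕ c) , inj₂ (w≡v , refl) , refl , refl
  ... | no w≢u | no w≢v = ⊥-elim (hub-link-apart (idx≢ w≢u) (idx≢ w≢v) (inner e c) touch)

  meet : ∀ x y → Touch G (place x) (place y) → x ≡ y ⊎ CommonEdge x y
  meet (inj₁ w) (inj₁ w′) touch with w ≟V w′
  ... | yes refl = inj₁ refl
  ... | no ne = ⊥-elim (hubs-apart (idx≢ ne) touch)
  meet (inj₁ w) (inj₂ (e , c)) touch = inj₂ (hub-meets-inner w e c touch)
  meet (inj₂ (e , c)) (inj₁ w) touch =
    let (e′ , p , q , aw , ac) = hub-meets-inner w e c (touch-sym simple touch) in inj₂ (e′ , q , p , ac , aw)
  meet (inj₂ (e@(u , v , _) , c)) (inj₂ (e′@(u′ , v′ , _) , c′)) touch with u ≟V u′ | v ≟V v′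
  ... | yes u≡u′ | yes v≡v′ = inj₂ (e′ , suc (toℕ c) , suc (toℕ c′) , (edge-≡ u≡u′ v≡v′ , refl) , (refl , refl))
  ... | no ne | _ = ⊥-elim (links-apart (λ { (eq , _) → ne (injective idx eq) }) (inner e c) (inner e′ c′) touch)
  ... | yes _ | no ne = ⊥-elim (links-apart (λ { (_ , eq) → ne (injective idx eq) }) (inner e c) (inner e′ c′) touch)

  web⇒subdivision : Contains (Sub ℓ) G
  web⇒subdivision = place , place-injective , λ x y → mk⇔ (forward x y) (backward x y)
    where
    place-injective : ∀ x y → place x ≡ place y → x ≡ y
    place-injective x y eq with meet x y (inj₁ eq)
    ... | inj₁ x≡y = x≡y
    ... | inj₂ (e , p , q , ax , ay) with place-at x ax | place-at y ay
    ...   | px , p≤ | py , q≤ with at-injective (segment-path e) p≤ q≤ (trans (sym px) (trans eq py))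
    ...     | refl = at-unique x y ax ay
    step : ∀ x y {e p} → At ℓ x e p → At ℓ y e (suc p) → G (place x) (place y)
    step x y {e} ax ay with place-at x ax | place-at y ay
    ... | px , _ | py , le = subst₂ G (sym px) (sym py) (at-step (segment-path e) le)
    forward : ∀ x y → Sub ℓ x y → G (place x) (place y)
    forward x y (e , p , inj₁ (ax , ay)) = step x y ax ay
    forward x y (e , p , inj₂ (ay , ax)) = proj₁ simple _ _ (step y x ay ax)
    backward : ∀ x y → G (place x) (place y) → Sub ℓ x y
    backward x y g with meet x y (inj₂ g)
    ... | inj₁ refl = ⊥-elim (proj₂ simple _ g)
    ... | inj₂ (e , p , q , ax , ay) with place-at x ax | place-at y ay
    ...   | px , p≤ | py , q≤ with at-adjacent (segment-path e) p≤ q≤ (subst₂ G px py g)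
    ...     | inj₁ refl = e , p , inj₁ (ax , ay)
    ...     | inj₂ refl = e , q , inj₂ (ay , ax)

wallIndex : ∀ t → WallV t ↣ Fin (t * (2 * t))
wallIndex t = mk↣ {to = λ { ((i , j) , _) → combine i j }}
  λ { {(i , j) , a} {(i′ , j′) , a′} eq → lemma a a′ (combine-injective i j i′ j′ eq) }
  where
  lemma : ∀ {i j i′ j′} a a′ → i ≡ i′ × j ≡ j′ → _≡_ {A = WallV t} ((i , j) , a) ((i′ , j′) , a′)
  lemma a a′ (refl , refl) = cong (_ ,_) (T-irrelevant a a′)

-- Bundles of short paths

clamp : ∀ l → ℕ → Fin (suc l)
clamp l zero = zero
clamp zero (suc p) = zero
clamp (suc l) (suc p) = suc (clamp l p)

toℕ-clamp : ∀ {l p} → p ≤ l → toℕ (clamp l p) ≡ p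
toℕ-clamp {l} {zero} le = refl
toℕ-clamp {suc l} {suc p} (s≤s le) = cong suc (toℕ-clamp le)

clamp-self : ∀ l → clamp l l ≡ fromℕ l
clamp-self zero = refl
clamp-self (suc l) = cong suc (clamp-self l)

module _ {n : ℕ} {G : Graph (Fin n)} {x y : Fin n} (P : Path G x y) where

  toSegment : Segment n
  toSegment = record { size = len P ; at = vtx P ∘ clamp (len P) }

  toSegment-isPath : IsPath G toSegment x y
  toSegment-isPath = record
    { at-start = start P
    ; at-end = trans (cong (vtx P) (clamp-self (len P))) (end P)
    ; at-injective = λ p≤ q≤ eq → trans (sym (toℕ-clamp p≤)) (trans (cong toℕ (inj P _ _ eq)) (toℕ-clamp q≤))
    ; at-step = λ {p} le → Equivalence.from (induced P _ _)
        (inj₁ (trans (cong suc (toℕ-clamp (≤-trans (n≤1+n p) le))) (sym (toℕ-clamp le))))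
    ; at-adjacent = λ p≤ q≤ g → subst₂ (λ p q → suc p ≡ q ⊎ suc q ≡ p) (toℕ-clamp p≤) (toℕ-clamp q≤)
        (Equivalence.to (induced P _ _) g)
    }

  inner⇒interior : ∀ {p} → Inner toSegment p → Interior P (at toSegment p)
  inner⇒interior {p} (0<p , p<len) =
    clamp (len P) p , subst (0 <_) (sym eq) 0<p , subst (_< len P) (sym eq) p<len , refl
    where eq = toℕ-clamp (<⇒≤ p<len)

-- The bundle from a vertex to itself carries no information, so that bundles exist for all pairs of ends.
record Bundle {n} (G : Graph (Fin n)) (d N : ℕ) (x y : Fin n) : Set where
  field
    strand : Fin N → Segment n
    strand-short : ∀ i → size (strand i) ≤ d
    strands-disjoint : ∀ {i j p q} → i ≢ j → Inner (strand i) p → Inner (strand j) q → at (strand i) p ≢ at (strand j) q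
    strand-path : x ≢ y → ∀ i → IsPath G (strand i) x y

open Bundle

restrict : ∀ {n} {G : Graph (Fin n)} {d L N x y} → Bundle G d N x y → Fin L ↣ Fin N → Bundle G d L x y
restrict b σ = record
  { strand = strand b ∘ to σ
  ; strand-short = strand-short b ∘ to σ
  ; strands-disjoint = λ ne → strands-disjoint b (ne ∘ injective σ)
  ; strand-path = λ x≢y → strand-path b x≢y ∘ to σ
  }

inner-vertices : ∀ {n} {G : Graph (Fin n)} {d N x y} (b : Bundle G d N x y) {p} → (∀ i → Inner (strand b i) p) → Fin N ↣ Fin n
inner-vertices b {p} inside = mk↣ {to = λ i → at (strand b i) p}
  λ {i} {j} eq → decidable-stable (i ≟ j) λ ne → strands-disjoint b ne (inside i) (inside j) eq

block⇒bundle : ∀ {n} {G : Graph (Fin n)} {d k B} → ShortBlock G d k B → ∀ {x y} → x ∈ B → y ∈ B → Bundle G d k x y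
block⇒bundle {d = d} (_ , joined) {x} {y} x∈B y∈B with x ≟ y
... | yes x≡y = record
  { strand = λ _ → record { size = 0 ; at = λ _ → x }
  ; strand-short = λ _ → z≤n
  ; strands-disjoint = λ { _ (_ , ()) }
  ; strand-path = λ x≢y → ⊥-elim (x≢y x≡y)
  }
... | no x≢y with joined x y x∈B y∈B x≢y
...   | ps , short , disjoint = record
  { strand = toSegment ∘ ps
  ; strand-short = short
  ; strands-disjoint = λ {i} {j} ne ip iq eq → proj₁ (disjoint i j ne) _ (inner⇒interior (ps i) ip)
      (subst (Interior (ps j)) (sym eq) (inner⇒interior (ps j) iq))
  ; strand-path = λ _ i → toSegment-isPath (ps i)
  }

members : ∀ {n} (B : Subset n) → Σ (Fin ∣ B ∣ ↣ Fin n) λ σ → ∀ i → to σ i ∈ B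
members [] = empty , λ ()
members (true ∷ B) with members B
... | σ , mem = cons σ , λ { zero → here ; (suc i) → there (mem i) }
members (false ∷ B) with members B
... | σ , mem = shift σ , λ i → there (mem i)

-- Clean graphs

module _ {n : ℕ} {G : Graph (Fin n)} (simple : Simple G) (G? : ∀ x y → Dec (G x y)) {t : ℕ}
  (no-clique : ¬ Contains (Complete t) G) where

  stable-subset : ∀ m (f : Fin (R (suc t) m) ↣ Fin n) →
    Σ (Fin m ↣ Fin (R (suc t) m)) λ σ → Pairwise (λ u v → ¬ G u v) (to f ∘ to σ)
  stable-subset m f with ramsey (suc t) m {λ i j → G (to f i) (to f j)} (λ i j → G? _ _) (proj₁ simple _ _)
  ... | inj₂ stable = stable
  ... | inj₁ (σ , clique) = ⊥-elim (no-clique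
    ( to f ∘ to σ
    , (λ _ _ → injective σ ∘ injective f)
    , λ i j → mk⇔ (clique i j) λ { g refl → proj₂ simple _ g }))

  no-touching-families : ¬ Contains (Biclique t) G →
    (a b : Fin (R (suc t) (2 + t)) ↣ Fin n) → ¬ (∀ i j → Touch G (to a i) (to b j))
  no-touching-families no-biclique a b touch with stable-subset (2 + t) a | stable-subset (2 + t) b
  ... | σ , σ-stable | τ , τ-stable = no-biclique (f , f-inj , f-adj)
    where
    other : (j : Fin (2 + t)) → ∃ λ j′ → j ≢ j′
    other zero = suc zero , λ ()
    other (suc j) = zero , λ ()
    -- A common vertex would touch, hence be adjacent to, the other members of its own stable family.
    distinct : ∀ i j → to a (to σ i) ≢ to b (to τ j)
    distinct i j eq with other j
    ... | j′ , j≢j′ with touch (to σ i) (to τ j′)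
    ...   | inj₁ eq′ = j≢j′ (injective τ (injective b (trans (sym eq) eq′)))
    ...   | inj₂ g = τ-stable j j′ j≢j′ (subst (λ u → G u _) eq g)
    joined : ∀ i j → G (to a (to σ i)) (to b (to τ j))
    joined i j with touch (to σ i) (to τ j)
    ... | inj₁ eq = ⊥-elim (distinct i j eq)
    ... | inj₂ g = g
    f : Fin t ⊎ Fin t → Fin n
    f (inj₁ i) = to a (to σ (2 ↑ʳ i))
    f (inj₂ j) = to b (to τ (2 ↑ʳ j))
    f-inj : ∀ x y → f x ≡ f y → x ≡ y
    f-inj (inj₁ i) (inj₁ j) eq = cong inj₁ (↑ʳ-injective 2 i j (injective σ (injective a eq)))
    f-inj (inj₁ i) (inj₂ j) eq = ⊥-elim (distinct _ _ eq)
    f-inj (inj₂ i) (inj₁ j) eq = ⊥-elim (distinct _ _ (sym eq))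
    f-inj (inj₂ i) (inj₂ j) eq = cong inj₂ (↑ʳ-injective 2 i j (injective τ (injective b eq)))
    nonadjacent : ∀ {k} {g : Fin k → Fin n} → Pairwise (λ u v → ¬ G u v) g → ∀ i j → ¬ G (g i) (g j)
    nonadjacent {g = g} stable i j e with i ≟ j
    ... | yes refl = proj₂ simple _ e
    ... | no ne = stable i j ne e
    f-adj : ∀ x y → Biclique t x y ⇔ G (f x) (f y)
    f-adj (inj₁ i) (inj₁ j) = mk⇔ (λ ()) (nonadjacent σ-stable _ _)
    f-adj (inj₁ i) (inj₂ j) = mk⇔ (λ _ → joined _ _) _
    f-adj (inj₂ i) (inj₁ j) = mk⇔ (λ _ → proj₁ simple _ _ (joined _ _)) _
    f-adj (inj₂ i) (inj₂ j) = mk⇔ (λ ()) (nonadjacent τ-stable _ _)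

encode : ∀ {a b c d} → Fin a → Fin b → Fin c → Fin d → Fin (a * (b * (c * d)))
encode i j k o = combine i (combine j (combine k o))

decode : ∀ {a b c d} → Fin (a * (b * (c * d))) → Fin a × Fin b × Fin c × Fin d
decode {a} {b} {c} {d} e = map₂ (map₂ (remQuot d) ∘ remQuot (c * d)) (remQuot (b * (c * d)) e)

decode-encode : ∀ {a b c d} (i : Fin a) (j : Fin b) (k : Fin c) (o : Fin d) → decode (encode i j k o) ≡ (i , j , k , o)
decode-encode {a} {b} {c} {d} i j k o =
  trans (cong (map₂ (map₂ (remQuot d) ∘ remQuot (c * d))) (remQuot-combine i (combine j (combine k o))))
    (cong (i ,_) (trans (cong (map₂ (remQuot d)) (remQuot-combine j (combine k o))) (cong (j ,_) (remQuot-combine k o))))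

strandCount : ℕ → ℕ → ℕ → ℕ
strandCount d T h = clearAllSize (d * d) T (h * h)

bundleSize : ℕ → ℕ → ℕ → ℕ → ℕ
bundleSize d T h m = homSize (m * d) (T + strandCount d T h)

module _ {n : ℕ} {G : Graph (Fin n)} (simple : Simple G) (G? : ∀ x y → Dec (G x y)) {T : ℕ}
  (no-touching : (a b : Fin T ↣ Fin n) → ¬ (∀ i j → Touch G (to a i) (to b j))) (d : ℕ) where

  touch? : ∀ u v → Dec (Touch G u v)
  touch? u v = (u ≟ v) ⊎-dec G? u v

  inner? : (S : Segment n) → ∀ p → Dec (Inner S p)
  inner? S p = (0 <? p) ×-dec (p <? size S)

  position : ∀ {S : Segment n} {p} → size S ≤ d → Inner S p → ∃ λ (p′ : Fin d) → toℕ p′ ≡ p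
  position short (_ , p<) = fromℕ< (≤-trans p< short) , toℕ-fromℕ< _

  Hit : Fin n → Fin d → Segment n → Set
  Hit u p S = Inner S (toℕ p) × Touch G u (at S (toℕ p))

  hit? : ∀ u p S → Dec (Hit u p S)
  hit? u p S = inner? S (toℕ p) ×-dec touch? u _

  Cross : Fin (d * d) → Segment n → Segment n → Set
  Cross r S S′ = let (p , q) = remQuot {d} d r in
    Inner S (toℕ p) × Inner S′ (toℕ q) × Touch G (at S (toℕ p)) (at S′ (toℕ q))

  cross? : ∀ r S S′ → Dec (Cross r S S′)
  cross? r S S′ = let (p , q) = remQuot {d} d r in
    inner? S (toℕ p) ×-dec (inner? S′ (toℕ q) ×-dec touch? (at S (toℕ p)) (at S′ (toℕ q)))

  Uncrossed : Segment n → Segment n → Set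
  Uncrossed = Apart cross? T

  uncrossed : ∀ {S S′} → Uncrossed S S′ → ∀ (p q : Fin d) → Inner S (toℕ p) → Inner S′ (toℕ q) →
    ¬ Touch G (at S (toℕ p)) (at S′ (toℕ q))
  uncrossed {S} {S′} apart p q ip iq touch = apart (combine p q)
    (subst (λ (p , q) → Inner S (toℕ p) × Inner S′ (toℕ q) × Touch G (at S (toℕ p)) (at S′ (toℕ q)))
      (sym (remQuot-combine p q)) (ip , iq , touch))

  uncrossed-sym : ∀ {S S′} → Uncrossed S S′ → Uncrossed S′ S
  uncrossed-sym {S} {S′} apart r (ip , iq , touch) =
    uncrossed {S} {S′} apart (proj₂ (remQuot {d} d r)) (proj₁ (remQuot {d} d r)) iq ip (touch-sym simple touch)

  module _ {m : ℕ} (b : Fin m ↣ Fin n) (stable : Pairwise (λ u v → ¬ G u v) (to b)) (h : ℕ)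
    (bundle : ∀ x y → Bundle G d (bundleSize d T h m) (to b x) (to b y)) where

    L : ℕ
    L = strandCount d T h

    homogeneous : ∀ x y → Σ (Bundle G d (T + L) (to b x) (to b y)) λ β → ∀ z p →
      (∀ i → Hit (to b z) p (strand β i)) ⊎ (∀ i → ¬ Hit (to b z) p (strand β i))
    homogeneous x y with homogenise (m * d) (T + L)
      (λ r i → hit? (to b (proj₁ (remQuot {m} d r))) (proj₂ (remQuot {m} d r)) (strand (bundle x y) i))
    ... | σ , const = restrict (bundle x y) σ , λ z p →
      subst (λ (z , p) → let β = restrict (bundle x y) σ in
               (∀ i → Hit (to b z) p (strand β i)) ⊎ (∀ i → ¬ Hit (to b z) p (strand β i)))
        (remQuot-combine z p) (const (combine z p))

    β : ∀ x y → Bundle G d (T + L) (to b x) (to b y)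
    β x y = proj₁ (homogeneous x y)

    Conflict : Fin h → Fin h → Fin h → Fin (suc d) → Vec (Fin m) h → Set
    Conflict i j k zero v = k ≢ i × lookup v k ≡ lookup v i
    Conflict i j k (suc p) v = k ≢ i × k ≢ j × (∀ l → Hit (to b (lookup v k)) p (strand (β (lookup v i) (lookup v j)) l))

    conflict? : ∀ i j k o v → Dec (Conflict i j k o v)
    conflict? i j k zero v = ¬? (k ≟ i) ×-dec (lookup v k ≟ lookup v i)
    conflict? i j k (suc p) v =
      ¬? (k ≟ i) ×-dec (¬? (k ≟ j) ×-dec all? (λ l → hit? (to b (lookup v k)) p (strand (β (lookup v i) (lookup v j)) l)))

    few-conflicts : ∀ i j k o v (σ : Fin (2 + T) ↣ Fin m) → ¬ (∀ c → Conflict i j k o (v [ k ]≔ to σ c))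
    few-conflicts i j k zero v σ conflict with injective σ (trans (same zero) (sym (same (suc zero))))
      where
      same : ∀ c → to σ c ≡ lookup v i
      same c with conflict c
      ... | k≢i , eq = trans (sym (lookup∘update k v _)) (trans eq (lookup∘update′ (k≢i ∘ sym) v _))
    ... | ()
    few-conflicts i j k (suc p) v σ conflict =
      no-touching (b ↣-∘ (σ ↣-∘ right 2)) (inner-vertices (restrict (β x y) (left L)) (λ l → proj₁ (hits zero (l ↑ˡ L))))
        (λ c l → proj₂ (hits (2 ↑ʳ c) (l ↑ˡ L)))
      where
      x = lookup v i
      y = lookup v j
      hits : ∀ c l → Hit (to b (to σ c)) p (strand (β x y) l)
      hits c with conflict c
      ... | k≢i , k≢j , hit rewrite lookup∘update k v (to σ c)
                                  | lookup∘update′ (k≢i ∘ sym) v (to σ c)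
                                  | lookup∘update′ (k≢j ∘ sym) v (to σ c) = hit

    good-tuple⇒web : ∀ v → (∀ i j k o → ¬ Conflict i j k o v) → Web G h
    good-tuple⇒web v good = record
      { hub = hub
      ; link = link
      ; link-path = λ i≢j → strand-path (γ _ _) (v-injective i≢j ∘ injective b) _
      ; hubs-apart = λ { i≢j (inj₁ eq) → v-injective i≢j (injective b eq)
                       ; i≢j (inj₂ g) → stable _ _ (v-injective i≢j) g }
      ; hub-link-apart = hub-link-apart
      ; links-apart = links-apart
      }
      where
      γ : ∀ i j → Bundle G d (T + L) (to b (lookup v i)) (to b (lookup v j))
      γ i j = β (lookup v i) (lookup v j)
      hub : Fin h → Fin n
      hub i = to b (lookup v i)
      v-injective : ∀ {i j} → i ≢ j → lookup v i ≢ lookup v j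
      v-injective {i} {j} i≢j eq = good j j i zero (i≢j , eq)
      family : Fin (h * h) → Fin L → Segment n
      family e l = let (i , j) = remQuot {h} h e in strand (γ i j) (T ↑ʳ l)
      no-rectangle : ∀ e e′ → NoRectangle cross? T (family e) (family e′)
      no-rectangle e e′ r (σ , τ , full) =
        let (i , j) = remQuot {h} h e
            (i′ , j′) = remQuot {h} h e′
        in no-touching
             (inner-vertices (restrict (γ i j) (right T ↣-∘ σ)) (λ k → proj₁ (full k k)))
             (inner-vertices (restrict (γ i′ j′) (right T ↣-∘ τ)) (λ k → proj₁ (proj₂ (full k k))))
             (λ k l → proj₂ (proj₂ (full k l)))
      choice = clear-all cross? T (λ {S} {S′} → uncrossed-sym {S} {S′}) (h * h) family (λ e e′ _ → no-rectangle e e′)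
      link : Fin h → Fin h → Segment n
      link i j = strand (γ i j) (T ↑ʳ proj₁ choice (combine i j))
      link-family : ∀ i j → family (combine i j) (proj₁ choice (combine i j)) ≡ link i j
      link-family i j = cong (λ (i′ , j′) → strand (γ i′ j′) (T ↑ʳ proj₁ choice (combine i j))) (remQuot-combine i j)
      hub-link-apart : ∀ {i j k p} → k ≢ i → k ≢ j → Inner (link i j) p → ¬ Touch G (hub k) (at (link i j) p)
      hub-link-apart {i} {j} {k} k≢i k≢j ip touch with position {link i j} (strand-short (γ i j) _) ip
      ... | p , refl with proj₂ (homogeneous (lookup v i) (lookup v j)) (lookup v k) p
      ...   | inj₁ hit = good i j k (suc p) (k≢i , k≢j , hit)
      ...   | inj₂ miss = miss _ (ip , touch)
      links-apart : ∀ {i j i′ j′ p q} → ¬ (i ≡ i′ × j ≡ j′) → Inner (link i j) p → Inner (link i′ j′) q →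
        ¬ Touch G (at (link i j) p) (at (link i′ j′) q)
      links-apart {i} {j} {i′} {j′} ne ip iq
        with position {link i j} (strand-short (γ i j) _) ip | position {link i′ j′} (strand-short (γ i′ j′) _) iq
      ... | p , refl | q , refl = uncrossed {link i j} {link i′ j′}
        (subst₂ Uncrossed (link-family i j) (link-family i′ j′)
          (proj₂ choice (combine i j) (combine i′ j′) (ne ∘ combine-injective i j i′ j′))) p q ip iq

    web-exists : h * (h * (h * suc d)) * suc T < m → ¬ ¬ Web G h
    web-exists large no-web = union-bound h (λ e → let (i , j , k , o) = decode {h} {h} {h} {suc d} e in conflict? i j k o)
      (λ e → let (_ , _ , k , _) = decode {h} {h} {h} {suc d} e in k)
      (λ e → let (i , j , k , o) = decode {h} {h} {h} {suc d} e in few-conflicts i j k o) large some-conflict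
      where
      some-conflict : ∀ v → ∃ λ e → let (i , j , k , o) = decode {h} {h} {h} {suc d} e in Conflict i j k o v
      some-conflict v with any? (λ e → let (i , j , k , o) = decode {h} {h} {h} {suc d} e in conflict? i j k o v)
      ... | yes found = found
      ... | no none = ⊥-elim (no-web (good-tuple⇒web v λ i j k o conflict →
        none (encode i j k o , subst (λ (i , j , k , o) → Conflict i j k o v) (sym (decode-encode i j k o)) conflict)))

¬¬-∀ : ∀ {n} {P : Fin n → Set} → (∀ i → ¬ ¬ P i) → ¬ ¬ (∀ i → P i)
¬¬-∀ {zero} nn k = k λ ()
¬¬-∀ {suc n} nn k = nn zero λ p → ¬¬-∀ (nn ∘ suc) λ ps → k λ { zero → p ; (suc i) → ps i }

theorem4p4 : ∀ (d t : ℕ) → ∃[ η ] (∀ (n : ℕ) (G : Graph (Fin n)) → Simple G → Clean t G →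
    ∀ (B : Subset n) → ¬ ShortBlock G d η B)
theorem4p4 d t = R (suc t) m + N , no-block
  where
  T₀ = R (suc t) (2 + t)
  h = t * (2 * t)
  m = suc (h * (h * (h * suc d)) * suc T₀)
  N = bundleSize d T₀ h m
  no-block : ∀ n (G : Graph (Fin n)) → Simple G → Clean t G → ∀ B → ¬ ShortBlock G d (R (suc t) m + N) B
  no-block n G simple (no-clique , no-biclique , no-wall , _) B block =
    ¬¬-∀ (λ x → ¬¬-∀ λ y → ¬¬-excluded-middle) λ (G? : ∀ x y → Dec (G x y)) →
      let (μ , ∈B) = members B
          f = μ ↣-∘ (mk↣ (inject≤-injective (proj₁ block) (proj₁ block) _ _) ↣-∘ left N)
          (σ , stable) = stable-subset simple G? no-clique m f
          no-touching = no-touching-families simple G? no-clique no-biclique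
          bundle = λ x y → restrict (block⇒bundle block (∈B _) (∈B _)) (right (R (suc t) m))
      in web-exists simple G? no-touching d (f ↣-∘ σ) stable h bundle ≤-refl
           λ web → no-wall _ (web⇒subdivision simple web wallAdjᵇ wallRank (wallIndex t))
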